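{- If $G$ is a finite simple undirected $(P_6,\text{house})$-free graph that has an efficient dominating set, then its square $G^2$ is odd-antihole-free.
   Context: All graphs are finite, undirected and simple. A vertex dominates itself and its neighbors. A set $D\subseteq V$ is an efficient dominating set of $G=(V,E)$ if every vertex of $G$ is dominated by exactly one vertex of $D$. The square $G^2=(V,E^2)$ has $uv\in E^2$ iff $d_G(u,v)\in\{1,2\}$. $P_k$ is the chordless path on $k$ vertices; the house is the complement of $P_5$. $(P_6,\text{house})$-free means having no induced subgraph isomorphic to $P_6$ or to the house. Odd-antihole-free means having no induced subgraph isomorphic to the complement $\overline{C_{2k+1}}$ of a chordless cycle on $2k+1$ vertices, $k\ge 2$. -}

module Defs where

open import Data.Fin using (Fin; toℕ; _≟_)
open import Data.Fin.Properties using (any?)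
open import Data.Fin.Subset using (Subset; _∈_)
open import Data.Nat as ℕ using (ℕ; zero; suc; _+_; _*_; _≤_; _<_; z≤n; s≤s)
open import Data.Nat.Properties using (allUpTo?; 1+n≢n)
open import Data.Product using (∃; ∃!; _×_; _,_)
open import Data.Sum using (_⊎_; inj₁; inj₂; swap)
open import Function.Bundles using (_⇔_)
open import Function.Definitions using (Injective)
open import Relation.Binary.Core using (Rel)
open import Relation.Binary.Definitions using (Symmetric; Irreflexive; Decidable)
open import Relation.Binary.PropositionalEquality using (_≡_; _≢_; refl; sym)
open import Relation.Nullary using (¬_; ¬?; _×-dec_; _⊎-dec_)
open import Level using (0ℓ)

record Graph (n : ℕ) : Set₁ where
  field
    Adj        : Rel (Fin n) 0ℓ
    adj-sym    : Symmetric Adj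
    adj-irrefl : Irreflexive _≡_ Adj
    adj?       : Decidable Adj

open Graph public

complement : ∀ {n} → Graph n → Graph n
complement G .Adj i j                      = i ≢ j × ¬ Adj G i j
complement G .adj-sym (i≢j , ¬ij)          = (λ j≡i → i≢j (sym j≡i)) , (λ ji → ¬ij (adj-sym G ji))
complement G .adj-irrefl i≡j (i≢j , _)     = i≢j i≡j
complement G .adj? i j                     = ¬? (i ≟ j) ×-dec ¬? (adj? G i j)

Consecutive : ∀ {n} → Rel (Fin n) 0ℓ
Consecutive i j = suc (toℕ i) ≡ toℕ j

path : ∀ n → Graph n
path n .Adj i j                    = Consecutive i j ⊎ Consecutive j i
path n .adj-sym                    = swap
path n .adj-irrefl refl (inj₁ eq)  = 1+n≢n eq
path n .adj-irrefl refl (inj₂ eq)  = 1+n≢n eq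
path n .adj? i j                   = (suc (toℕ i) ℕ.≟ toℕ j) ⊎-dec (suc (toℕ j) ℕ.≟ toℕ i)

FirstLast : ∀ {n} → Rel (Fin n) 0ℓ
FirstLast {n} i j = toℕ i ≡ 0 × suc (toℕ j) ≡ n

-- The cycle C_n is the path P_n with its two ends joined. It is a cycle in the
-- usual sense for n ≥ 3; the condition i ≢ j only matters for n = 1, where it
-- excludes a loop.
cycle : ∀ n → Graph n
cycle n .Adj i j = Adj (path n) i j ⊎ (i ≢ j × (FirstLast i j ⊎ FirstLast j i))
cycle n .adj-sym (inj₁ p)               = inj₁ (adj-sym (path n) p)
cycle n .adj-sym (inj₂ (i≢j , e))       = inj₂ ((λ j≡i → i≢j (sym j≡i)) , swap e)
cycle n .adj-irrefl i≡j (inj₁ p)        = adj-irrefl (path n) i≡j p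
cycle n .adj-irrefl i≡j (inj₂ (i≢j , _)) = i≢j i≡j
cycle n .adj? i j =
  adj? (path n) i j ⊎-dec (¬? (i ≟ j) ×-dec (firstLast? i j ⊎-dec firstLast? j i))
  where
  firstLast? : Decidable (FirstLast {n})
  firstLast? i j = (toℕ i ℕ.≟ 0) ×-dec (suc (toℕ j) ℕ.≟ n)

house : Graph 5
house = complement (path 5)

-- An isomorphism from H onto the subgraph of G induced by the image of `vertex`.
record InducedCopy {m n} (H : Graph m) (G : Graph n) : Set where
  field
    vertex    : Fin m → Fin n
    injective : Injective _≡_ _≡_ vertex
    induced   : ∀ i j → Adj H i j ⇔ Adj G (vertex i) (vertex j)

_FreeOf_ : ∀ {m n} → Graph n → Graph m → Set
G FreeOf H = ¬ InducedCopy H G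

OddAntiholeFree : ∀ {n} → Graph n → Set
OddAntiholeFree G = ∀ k → 2 ≤ k → G FreeOf complement (cycle (2 * k + 1))

Dominates : ∀ {n} → Graph n → Rel (Fin n) 0ℓ
Dominates G d v = d ≡ v ⊎ Adj G d v

EfficientDominatingSet : ∀ {n} → Graph n → Subset n → Set
EfficientDominatingSet G D = ∀ v → ∃! _≡_ λ d → d ∈ D × Dominates G d v

Walk : ∀ {n} → Graph n → ℕ → Rel (Fin n) 0ℓ
Walk G zero    u v = u ≡ v
Walk G (suc k) u v = ∃ λ w → Adj G u w × Walk G k w v

-- d_G(u,v) = k. As a relation, since the distance between vertices in different
-- components is infinite.
Distance : ∀ {n} → Graph n → Fin n → Fin n → ℕ → Set
Distance G u v k = Walk G k u v × (∀ {j} → j < k → ¬ Walk G j u v)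

walk? : ∀ {n} (G : Graph n) k → Decidable (Walk G k)
walk? G zero    u v = u ≟ v
walk? G (suc k) u v = any? λ w → adj? G u w ×-dec walk? G k w v

walk-snoc : ∀ {n} (G : Graph n) k {u v w} → Walk G k u v → Adj G v w → Walk G (suc k) u w
walk-snoc G zero    refl          vw = _ , vw , refl
walk-snoc G (suc k) (x , ux , xv) vw = x , ux , walk-snoc G k xv vw

walk-sym : ∀ {n} (G : Graph n) k → Symmetric (Walk G k)
walk-sym G zero    u≡v           = sym u≡v
walk-sym G (suc k) (x , ux , xv) = walk-snoc G k (walk-sym G k xv) (adj-sym G ux)

distance? : ∀ {n} (G : Graph n) k → Decidable (λ u v → Distance G u v k)
distance? G k u v = walk? G k u v ×-dec allUpTo? (λ j → ¬? (walk? G j u v)) k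

distance-sym : ∀ {n} (G : Graph n) k → Symmetric (λ u v → Distance G u v k)
distance-sym G k (uv , min) = walk-sym G k uv , λ {j} j<k vu → min j<k (walk-sym G j vu)

square : ∀ {n} → Graph n → Graph n
square G .Adj u v                         = Distance G u v 1 ⊎ Distance G u v 2
square G .adj-sym (inj₁ d)                = inj₁ (distance-sym G 1 d)
square G .adj-sym (inj₂ d)                = inj₂ (distance-sym G 2 d)
square G .adj-irrefl u≡v (inj₁ (_ , min)) = min (s≤s z≤n) u≡v
square G .adj-irrefl u≡v (inj₂ (_ , min)) = min (s≤s z≤n) u≡v
square G .adj? u v                        = distance? G 1 u v ⊎-dec distance? G 2 u v

{-# OPTIONS --safe #-}
-- Call two vertices far if their distance is at least three, and close otherwise. An
-- antihole of G² is a cyclic sequence v₀, v₁, … of vertices of G in which consecutive ones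
-- are far and all other pairs are close. Far vertices have different dominators. If v_i and
-- v_{i+2} always had the same dominator then, the length being odd, so would all the v_i;
-- hence some three consecutive vertices have pairwise different dominators. Number them 1,
-- 2, 3. If the length is five the whole cycle, and otherwise the six vertices v₀, …, v₅,
-- already contradict the absence of P₆ and of the house: this is a finite case analysis on
-- the adjacencies between the v_i, common neighbours w_ij of pairs at distance two, and the
-- dominators of these vertices, found by computer search and checked by evaluation.
-- Replacing each vertex by two adjacent twins creates no new P₆ or house and lets us assume
-- that no v_i or w_ij is a dominator.
module Submission where

open import Defs
open import Data.Bool using (Bool; true; false; not)
import Data.Bool as Bool
open import Data.Empty using (⊥)
open import Data.Fin using (Fin; toℕ; _≟_; zero; suc)
open import Data.Fin.Properties using (any?; all?; toℕ-injective; toℕ<n; toℕ-fromℕ<)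
open import Data.List using (List; []; _∷_; _++_; map)
open import Data.List.Relation.Unary.All using (All; []; _∷_)
import Data.List.Relation.Unary.All as All
open import Data.List.Relation.Unary.All.Properties using (++⁺; ++⁻ˡ; ++⁻ʳ; map⁺)
open import Data.Maybe using (Maybe; just; nothing; _>>=_; _<∣>_; from-just)
import Data.Maybe as Maybe
open import Data.Nat using
  (ℕ; zero; suc; _+_; _*_; _∸_; _≤_; _<_; _≤?_; _<?_; z≤n; s≤s; NonZero)
import Data.Nat as ℕ
open import Data.Nat.DivMod using
  (_%_; _mod_; %-distribˡ-+; m<n⇒m%n≡m; m%n<n; n%n≡0; m%n%n≡m%n; m≤n⇒[n∸m]%m≡n%m; [m+n]%n≡m%n)
import Data.Nat.Properties as ℕ
open import Data.Product using (∃; Σ-syntax; _×_; _,_; proj₁; proj₂; map₂)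
import Data.Product as Product
open import Data.Sum using (_⊎_; inj₁; inj₂; [_,_]′)
open import Data.Vec using (Vec; []; _∷_; lookup; toList)
open import Function using (_∘_; id; flip; _$_)
open import Function.Bundles using (_⇔_; mk⇔; Equivalence)
open import Relation.Binary.Definitions using (tri<; tri≈; tri>)
open import Relation.Binary.PropositionalEquality using
  (_≡_; _≢_; refl; sym; trans; cong; cong₂; subst; module ≡-Reasoning)
open import Relation.Nullary using (¬_; Dec; yes; no; contradiction; ¬?; _×-dec_; _⊎-dec_)
open import Relation.Nullary.Decidable using (True; toWitness; from-yes)

open Equivalence using (to; from)
open InducedCopy

-- Certificates for finite case analyses.

-- Names of outer points: v i is the i-th vertex of the window under consideration, and
-- w i j a common neighbour of v i and v j, meaningful only if they are at distance two.
data Name : Set where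
  v : ℕ → Name
  w : ℕ → ℕ → Name

-- centre p is the vertex of the efficient dominating set that dominates p.
data Point : Set where
  outer  : Name → Point
  centre : Name → Point

-- Different names may denote the same vertex, so only equality is certified and nothing is ever
-- concluded from a failed comparison.
_≟ⁿ_ : (p q : Name) → Maybe (p ≡ q)
v i   ≟ⁿ v j with i ℕ.≟ j
... | yes refl = just refl
... | no _     = nothing
w i j ≟ⁿ w k l with i ℕ.≟ k | j ℕ.≟ l
... | yes refl | yes refl = just refl
... | _        | _        = nothing
_     ≟ⁿ _     = nothing

_≟ᵖ_ : (p q : Point) → Maybe (p ≡ q)
outer p  ≟ᵖ outer q  = Maybe.map (cong outer) (p ≟ⁿ q)
centre p ≟ᵖ centre q = Maybe.map (cong centre) (p ≟ⁿ q)
_        ≟ᵖ _        = nothing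

record Literal : Set where
  constructor lit
  field
    sign : Bool
    x y  : Point

pattern _∼_ x y = lit true x y
pattern _≁_ x y = lit false x y

negate : Literal → Literal
negate (lit s x y) = lit (not s) x y

record Facts : Set where
  constructor facts
  field
    literals   : List Literal
    farPairs   : List (Point × Point)
    closePairs : List (ℕ × ℕ)

open Facts

-- The steps of a case analysis, continued by the arguments of type Refutation:
--   split x y    x and y are adjacent or not;
--   witness i j  v i and v j are close but not adjacent, so w i j is a common neighbour;
--   star p       the centre of p is far from every known centre not adjacent to p;
--   P₆, House    one of the literals of the forbidden pattern fails: if all but one are
--                known, the negation of the last is learnt, and if all are known the
--                facts are contradictory and the continuation (■) is not used.
data Refutation : Set where
  ■       : Refutation
  split   : (x y : Point) → (adjacent nonadjacent : Refutation) → Refutation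
  witness : (i j : ℕ) → Refutation → Refutation
  star    : (p : Name) → Refutation → Refutation
  P₆      : (a b c d e f : Point) → Refutation → Refutation
  House   : (a b c d e : Point) → Refutation → Refutation

-- An induced path (sign true) or the complement of one (sign false); in the latter the
-- points are listed along the path of the complement.
chain : ∀ {k} → Bool → Vec Point k → List Literal
chain s []           = []
chain s (x ∷ [])     = []
chain s (x ∷ y ∷ xs) = lit s x y ∷ map (lit (not s) x) (toList xs) ++ chain s (y ∷ xs)

-- Twins and the doubled graph.

Distinguishes : ∀ {k} → Graph k → Fin k → Fin k → Set
Distinguishes H i j = ∃ λ l → Adj H i l × l ≢ j × ¬ Adj H j l

-- Rules out adjacent and nonadjacent twins alike: in `Distinguishes` the vertex `l` differs from
-- `j`, so an edge between `i` and `j` does not tell them apart.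
TwinFree : ∀ {k} → Graph k → Set
TwinFree H = ∀ i j → i ≡ j ⊎ Distinguishes H i j ⊎ Distinguishes H j i

twinFree? : ∀ {k} (H : Graph k) → Dec (TwinFree H)
twinFree? H = all? λ i → all? λ j → (i ≟ j) ⊎-dec distinguishes? i j ⊎-dec distinguishes? j i
  where
  distinguishes? : ∀ i j → Dec (Distinguishes H i j)
  distinguishes? i j = any? λ l → adj? H i l ×-dec ¬? (l ≟ j) ×-dec ¬? (adj? H j l)

-- Every vertex is doubled into two adjacent twins. A graph without twins embeds in the
-- doubled graph only if it embeds in G.
module Doubled {n} (G : Graph n) where

  V : Set
  V = Fin n × Bool

  infix 4 _~_
  _~_ : V → V → Set
  (x , b) ~ (y , c) = Adj G x y ⊎ (x ≡ y × b ≢ c)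

  ~-sym : ∀ {p q} → p ~ q → q ~ p
  ~-sym (inj₁ xy)          = inj₁ (adj-sym G xy)
  ~-sym (inj₂ (x≡y , b≢c)) = inj₂ (sym x≡y , b≢c ∘ sym)

  ~-irrefl : ∀ {p} → ¬ (p ~ p)
  ~-irrefl (inj₁ xx)        = adj-irrefl G refl xx
  ~-irrefl (inj₂ (_ , b≢b)) = b≢b refl

  _~?_ : ∀ p q → Dec (p ~ q)
  (x , b) ~? (y , c) = adj? G x y ⊎-dec ((x ≟ y) ×-dec ¬? (b Bool.≟ c))

  ~⇒dominates : ∀ {p q} → p ~ q → Dominates G (proj₁ p) (proj₁ q)
  ~⇒dominates (inj₁ xy)        = inj₂ xy
  ~⇒dominates (inj₂ (x≡y , _)) = inj₁ x≡y

  -- Two vertices of `H` sent to copies of one vertex of `G` would have the same neighbours apart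
  -- from each other, so they would be twins. Hence the first projection stays injective, and no
  -- edge of the image joins two copies of one vertex.
  embedding⇒copy : ∀ {k} {H : Graph k} → TwinFree H →
                   (f : Fin k → V) → (∀ i j → Adj H i j ⇔ f i ~ f j) →
                   InducedCopy H G
  embedding⇒copy {k} {H} twinFree f embeds = record
    { vertex    = proj₁ ∘ f
    ; injective = λ {i} {j} → injective′ i j
    ; induced   = λ i j → mk⇔ (forth i j) (λ xy → from (embeds i j) (inj₁ xy))
    }
    where
    f-injective : ∀ {i j} → f i ≡ f j → i ≡ j
    f-injective {i} {j} eq with twinFree i j
    ... | inj₁ i≡j = i≡j
    ... | inj₂ (inj₁ (l , il , _ , ¬jl)) =
      contradiction (from (embeds j l) (subst (_~ f l) eq (to (embeds i l) il))) ¬jl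
    ... | inj₂ (inj₂ (l , jl , _ , ¬il)) =
      contradiction (from (embeds i l) (subst (_~ f l) (sym eq) (to (embeds j l) jl))) ¬il

    transfer : ∀ i j l → proj₁ (f i) ≡ proj₁ (f j) → Adj H i l → l ≢ j → Adj H j l
    transfer i j l eq il l≢j with to (embeds i l) il | proj₂ (f j) Bool.≟ proj₂ (f l)
    ... | inj₁ xz        | _       =
      from (embeds j l) (inj₁ (subst (λ x → Adj G x (proj₁ (f l))) eq xz))
    ... | inj₂ (x≡z , _) | no b≢c  =
      from (embeds j l) (inj₂ (trans (sym eq) x≡z , b≢c))
    -- Here `f j` and `f l` are the same point of the doubling, against `l ≢ j`.
    ... | inj₂ (x≡z , _) | yes b≡c =
      contradiction (sym (f-injective (cong₂ _,_ (trans (sym eq) x≡z) b≡c))) l≢j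

    injective′ : ∀ i j → proj₁ (f i) ≡ proj₁ (f j) → i ≡ j
    injective′ i j eq with twinFree i j
    ... | inj₁ i≡j = i≡j
    ... | inj₂ (inj₁ (l , il , l≢j , ¬jl)) = contradiction (transfer i j l eq il l≢j) ¬jl
    ... | inj₂ (inj₂ (l , jl , l≢i , ¬il)) = contradiction (transfer j i l (sym eq) jl l≢i) ¬il

    forth : ∀ i j → Adj H i j → Adj G (proj₁ (f i)) (proj₁ (f j))
    forth i j ij with to (embeds i j) ij
    ... | inj₁ xy        = xy
    ... | inj₂ (x≡y , _) = contradiction ij (adj-irrefl H (injective′ i j x≡y))

path₆-twinFree : TwinFree (path 6)
path₆-twinFree = from-yes (twinFree? (path 6))

house-twinFree : TwinFree house
house-twinFree = from-yes (twinFree? house)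

-- Models and the meaning of points and literals.

Close : ∀ {n} → Graph n → Fin n → Fin n → Set
Close G x y = Adj G x y ⊎ ∃ λ z → Adj G x z × Adj G z y

-- The efficient dominating set enters only as the function `dominator`; `unique` is efficiency
-- stated for its values. Indexing `vertexAt` by all of ℕ gives every name a meaning.
record Model : Set₁ where
  field
    {n}        : ℕ
    G          : Graph n
    path-free  : G FreeOf path 6
    house-free : G FreeOf house
    dominator  : Fin n → Fin n
    dominates  : ∀ x → Dominates G (dominator x) x
    unique     : ∀ {x y z} → Dominates G (dominator x) z → Dominates G (dominator y) z →
                 dominator x ≡ dominator y
    vertexAt   : ℕ → Fin n

module Semantics (M : Model) where
  open Model M
  open Doubled G

  commonNeighbour : Fin n → Fin n → Fin n
  commonNeighbour x y with any? (λ z → adj? G x z ×-dec adj? G z y)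
  ... | yes (z , _) = z
  -- A default value: that `w i j` is a common neighbour is asserted only by `witness`, which first
  -- shows that one exists.
  ... | no _        = x

  commonNeighbour-spec : ∀ {x y z} → Adj G x z → Adj G z y →
                         Adj G (commonNeighbour x y) x × Adj G (commonNeighbour x y) y
  commonNeighbour-spec {x} {y} xz zy with any? (λ z → adj? G x z ×-dec adj? G z y)
  ... | yes (_ , xz′ , z′y) = adj-sym G xz′ , z′y
  ... | no ∄z               = contradiction (_ , xz , zy) ∄z

  ⟦_⟧ⁿ : Name → Fin n
  ⟦ v i ⟧ⁿ   = vertexAt i
  ⟦ w i j ⟧ⁿ = commonNeighbour (vertexAt i) (vertexAt j)

  -- Centres lie on the other side of the doubling, so that a vertex of the dominating set
  -- also is adjacent to, and distinct from, its centre.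
  ⟦_⟧ : Point → V
  ⟦ outer p ⟧  = ⟦ p ⟧ⁿ , true
  ⟦ centre p ⟧ = dominator ⟦ p ⟧ⁿ , false

  Signed : Bool → Set → Set
  Signed true  A = A
  Signed false A = ¬ A

  Holds : Literal → Set
  Holds (lit s x y) = Signed s (⟦ x ⟧ ~ ⟦ y ⟧)

  -- Far points are distinct: every point is adjacent to its twin, so it shares a neighbour with
  -- itself.
  Far : V → V → Set
  Far p q = ¬ (p ~ q) × (∀ {r} → p ~ r → ¬ (q ~ r))

  Far-sym : ∀ {p q} → Far p q → Far q p
  Far-sym (p≁q , apart) = p≁q ∘ ~-sym , λ qr pr → apart pr qr

  FarHolds : Point × Point → Set
  FarHolds (x , y) = Far ⟦ x ⟧ ⟦ y ⟧

  CloseHolds : ℕ × ℕ → Set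
  CloseHolds (i , j) = Close G (vertexAt i) (vertexAt j)

  close? : ∀ cs i j → Maybe (All CloseHolds cs → CloseHolds (i , j))
  close? []             i j = nothing
  close? ((k , l) ∷ cs) i j with k ℕ.≟ i | l ℕ.≟ j
  ... | yes refl | yes refl = just All.head
  ... | _        | _        = Maybe.map (_∘ All.tail) (close? cs i j)

  Valid : Facts → Set
  Valid (facts ls fs cs) = All Holds ls × All FarHolds fs × All CloseHolds cs

  Contradictory : Facts → Set
  Contradictory Γ = ¬ Valid Γ

  Signed-map : ∀ s {A B : Set} → (A → B) → (B → A) → Signed s A → Signed s B
  Signed-map true  f g = f
  Signed-map false f g = _∘ g

  Holds-sym : ∀ s {x y} → Holds (lit s x y) → Holds (lit s y x)
  Holds-sym s = Signed-map s ~-sym ~-sym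

  holds? : ∀ l → Holds l ⊎ Holds (negate l)
  holds? (lit s x y) with s | ⟦ x ⟧ ~? ⟦ y ⟧
  ... | true  | yes p = inj₁ p
  ... | true  | no ¬p = inj₂ ¬p
  ... | false | yes p = inj₂ p
  ... | false | no ¬p = inj₁ ¬p

  -- Deriving literals from edges, far pairs and centres.

  matches : ∀ k l → Maybe (Holds k → Holds l)
  matches (lit s a b) (lit t x y) with s Bool.≟ t
  ... | no _     = nothing
  ... | yes refl =
    (do refl ← a ≟ᵖ x; refl ← b ≟ᵖ y; just id) <∣>
    (do refl ← a ≟ᵖ y; refl ← b ≟ᵖ x; just (Holds-sym s {a} {b}))

  entails : ∀ ls l → Maybe (All Holds ls → Holds l)
  entails []       l = nothing
  entails (k ∷ ks) l =
    Maybe.map (_∘ All.head) (matches k l) <∣> Maybe.map (_∘ All.tail) (entails ks l)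

  -- A neighbour of one of two far points is not adjacent to the other. Either end of the edge may
  -- be either member of the far pair, which gives four attempts.
  consequences : ∀ (l : Literal) (xy : Point × Point) →
                 Σ[ ls ∈ List Literal ] (Holds l → FarHolds xy → All Holds ls)
  consequences (a ≁ b) _       = [] , λ _ _ → []
  consequences (a ∼ b) (x , y) =
    merge (end a b x y id id) (merge (end b a x y ~-sym id)
      (merge (end a b y x id Far-sym) (end b a y x ~-sym Far-sym)))
    where
    Derived : Set
    Derived = Σ[ ls ∈ List Literal ] (Holds (a ∼ b) → FarHolds (x , y) → All Holds ls)
    merge : Derived → Derived → Derived
    merge (ks , p) (ls , q) = ks ++ ls , λ ab xy → ++⁺ (p ab xy) (q ab xy)
    end : ∀ c d p q → (Holds (a ∼ b) → Holds (c ∼ d)) →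
          (FarHolds (x , y) → FarHolds (p , q)) → Derived
    end c d p q f g with c ≟ᵖ p
    ... | nothing   = [] , λ _ _ → []
    ... | just refl = (q ≁ d) ∷ [] , λ ab xy → proj₂ (g xy) (f ab) ∷ []

  gather : ∀ {A H : Set} {P : A → Set} →
           (∀ a → Σ[ ls ∈ List Literal ] (H → P a → All Holds ls)) →
           ∀ as → Σ[ ls ∈ List Literal ] (H → All P as → All Holds ls)
  gather f []       = [] , λ _ _ → []
  gather f (a ∷ as) with f a | gather f as
  ... | ks , p | ls , q = ks ++ ls , λ { h (pa ∷ pas) → ++⁺ (p h pa) (q h pas) }

  Extension : Facts → Set → Set
  Extension Γ A = Σ[ Δ ∈ Facts ] (A → Valid Γ → Valid Δ)

  -- The derived literals are nonadjacencies, from which `consequences` draws nothing; a single pass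
  -- therefore saturates the facts.
  addLiteral : ∀ Γ l → Extension Γ (Holds l)
  addLiteral (facts ls fs cs) l with gather (consequences l) fs
  ... | ks , p = facts (l ∷ ks ++ ls) fs cs ,
                 λ { h (hs , ff , cc) → h ∷ ++⁺ (p h ff) hs , ff , cc }

  addFar : ∀ Γ xy → Extension Γ (FarHolds xy)
  addFar (facts ls fs cs) xy@(x , y)
    with gather {H = FarHolds xy} (λ l → map₂ flip (consequences l xy)) ls
  ... | ks , p = facts ((x ≁ y) ∷ ks ++ ls) (xy ∷ fs) cs ,
                 λ { far (hs , ff , cc) → (proj₁ far ∷ ++⁺ (p far hs) hs) , (far ∷ ff) , cc }

  _▷_ : ∀ {Γ A B} → (E : Extension Γ A) → Extension (proj₁ E) B → Extension Γ (A × B)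
  (Δ , p) ▷ (Θ , q) = Θ , λ { (a , b) → q b ∘ p a }

  centre-adjacent : ∀ p → Holds (centre p ∼ outer p)
  centre-adjacent p with dominates ⟦ p ⟧ⁿ
  ... | inj₁ eq  = inj₂ (eq , λ ())
  ... | inj₂ adj = inj₁ adj

  -- By efficiency, dominators that are adjacent or share a neighbour coincide. But the centre of
  -- `p` is adjacent to `outer p`, and the centre of `q` is not.
  centres-far : ∀ p q → ¬ (⟦ centre q ⟧ ~ ⟦ outer p ⟧) → Far ⟦ centre p ⟧ ⟦ centre q ⟧
  centres-far p q q≁p = (λ pq → distinct (unique (~⇒dominates pq) (inj₁ refl))) ,
                        λ pr qr → distinct (unique (~⇒dominates pr) (~⇒dominates qr))
    where
    distinct : dominator ⟦ p ⟧ⁿ ≢ dominator ⟦ q ⟧ⁿ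
    distinct eq = q≁p (subst (λ d → (d , false) ~ ⟦ outer p ⟧) eq (centre-adjacent p))

  separate : ∀ p (l : Literal) → Maybe (Σ[ q ∈ Name ] (Holds l → FarHolds (centre p , centre q)))
  separate p (centre q ≁ outer r) with p ≟ⁿ r
  ... | just refl = just (q , centres-far p q)
  ... | nothing   = nothing
  separate p (outer r ≁ centre q) with p ≟ⁿ r
  ... | just refl = just (q , centres-far p q ∘ (_∘ ~-sym))
  ... | nothing   = nothing
  separate p _ = nothing

  addStars : ∀ p ls Γ → Extension Γ (All Holds ls)
  addStars p []       Γ = Γ , λ _ Γ✓ → Γ✓
  addStars p (l ∷ ls) Γ with separate p l
  ... | nothing      = map₂ (_∘ All.tail) (addStars p ls Γ)
  ... | just (q , f) with addFar Γ (centre p , centre q)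
  ... | Δ , g with addStars p ls Δ
  ... | Θ , h = Θ , λ { (hl ∷ hls) Γ✓ → h hls (g (f hl) Γ✓) }

  unproved : ∀ Γ ls → Σ[ ks ∈ List Literal ] (Valid Γ → All Holds ks → All Holds ls)
  unproved Γ []       = [] , λ _ _ → []
  unproved Γ (l ∷ ls) with entails (literals Γ) l | unproved Γ ls
  ... | just p  | ks , q = ks , λ Γ✓ hks → p (proj₁ Γ✓) ∷ q Γ✓ hks
  ... | nothing | ks , q = l ∷ ks , λ { Γ✓ (hl ∷ hks) → hl ∷ q Γ✓ hks }

  -- Chains of literals as forbidden induced subgraphs.

  chain-consecutive : ∀ {k} s (xs : Vec Point k) → All Holds (chain s xs) →
                      ∀ i j → Consecutive i j → Signed s (⟦ lookup xs i ⟧ ~ ⟦ lookup xs j ⟧)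
  chain-consecutive s (x ∷ y ∷ xs) (h ∷ hs) zero    (suc zero) refl = h
  chain-consecutive s (x ∷ y ∷ xs) (h ∷ hs) (suc i) (suc j)    eq   =
    chain-consecutive s (y ∷ xs) (++⁻ʳ _ hs) i j (ℕ.suc-injective eq)

  chain-distant : ∀ {k} s (xs : Vec Point k) → All Holds (chain s xs) →
                  ∀ i j → suc (toℕ i) < toℕ j → Signed (not s) (⟦ lookup xs i ⟧ ~ ⟦ lookup xs j ⟧)
  chain-distant s (x ∷ y ∷ xs) (h ∷ hs) zero    (suc (suc j)) lt =
    first xs (++⁻ˡ _ hs) j
    where
    first : ∀ {k} (xs : Vec Point k) → All Holds (map (lit (not s) x) (toList xs)) →
            ∀ j → Signed (not s) (⟦ x ⟧ ~ ⟦ lookup xs j ⟧)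
    first (_ ∷ _)  (h ∷ _)  zero    = h
    first (_ ∷ xs) (_ ∷ hs) (suc j) = first xs hs j
  chain-distant s (x ∷ y ∷ xs) (h ∷ hs) (suc i) (suc j) (s≤s lt) =
    chain-distant s (y ∷ xs) (++⁻ʳ _ hs) i j lt
  chain-distant s (x ∷ []) _ zero zero ()
  chain-distant s (x ∷ y ∷ xs) _ zero (suc zero) (s≤s ())

  chain-adjacent : ∀ {k} s (xs : Vec Point k) → All Holds (chain s xs) →
                   ∀ {i j} → Adj (path k) i j → Signed s (⟦ lookup xs i ⟧ ~ ⟦ lookup xs j ⟧)
  chain-adjacent s xs hs {i} {j} (inj₁ eq) = chain-consecutive s xs hs i j eq
  chain-adjacent s xs hs {i} {j} (inj₂ eq) =
    Signed-map s ~-sym ~-sym (chain-consecutive s xs hs j i eq)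

  chain-nonadjacent : ∀ {k} s (xs : Vec Point k) → All Holds (chain s xs) →
                      ∀ {i j} → Adj (complement (path k)) i j →
                      Signed (not s) (⟦ lookup xs i ⟧ ~ ⟦ lookup xs j ⟧)
  chain-nonadjacent s xs hs {i} {j} (i≢j , ¬ij) with ℕ.<-cmp (toℕ i) (toℕ j)
  ... | tri< i<j _ _ = chain-distant s xs hs i j (ℕ.≤∧≢⇒< i<j (¬ij ∘ inj₁))
  ... | tri≈ _ i≡j _ = contradiction (toℕ-injective i≡j) i≢j
  ... | tri> _ _ j<i =
    Signed-map (not s) ~-sym ~-sym (chain-distant s xs hs j i (ℕ.≤∧≢⇒< j<i (¬ij ∘ inj₂)))

  -- The literals of a chain fix adjacencies only; that different positions carry different vertices
  -- of `G` comes from `embedding⇒copy`.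
  no-P₆ : ∀ (xs : Vec Point 6) → ¬ All Holds (chain true xs)
  no-P₆ xs hs = path-free (embedding⇒copy path₆-twinFree (⟦_⟧ ∘ lookup xs) λ i j →
    mk⇔ (chain-adjacent true xs hs) (back i j))
    where
    back : ∀ i j → ⟦ lookup xs i ⟧ ~ ⟦ lookup xs j ⟧ → Adj (path 6) i j
    back i j ij with i ≟ j | adj? (path 6) i j
    ... | yes refl | _       = contradiction ij ~-irrefl
    ... | no _     | yes adj = adj
    ... | no i≢j   | no ¬adj = contradiction ij (chain-nonadjacent true xs hs (i≢j , ¬adj))

  no-house : ∀ (xs : Vec Point 5) → ¬ All Holds (chain false xs)
  no-house xs hs = house-free (embedding⇒copy house-twinFree (⟦_⟧ ∘ lookup xs) λ i j →
    mk⇔ (chain-nonadjacent false xs hs)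
        (λ ij → (λ { refl → ~-irrefl ij }) , (λ adj → chain-adjacent false xs hs adj ij)))

  -- The certificate checker.

  mutual
    -- Soundness is part of the result: `just` carries a proof of contradiction, whereas `nothing`
    -- only says that the certificate does not establish one.
    check : ∀ Γ → Refutation → Maybe (Contradictory Γ)
    check Γ ■ = nothing
    check Γ (split x y r s) = do
      f ← assume Γ (x ∼ y) r
      g ← assume Γ (x ≁ y) s
      just λ Γ✓ → [ flip f Γ✓ , flip g Γ✓ ]′ (holds? (x ∼ y))
    check Γ (witness i j r) = do
      p ← entails (literals Γ) (outer (v i) ≁ outer (v j))
      c ← close? (closePairs Γ) i j
      f ← recheck (addLiteral Γ (outer (w i j) ∼ outer (v i)) ▷
                   addLiteral _ (outer (w i j) ∼ outer (v j))) r
      just λ Γ✓ → f (common (p (proj₁ Γ✓)) (c (proj₂ (proj₂ Γ✓)))) Γ✓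
      where
      common : ∀ {i j} → Holds (outer (v i) ≁ outer (v j)) → Close G (vertexAt i) (vertexAt j) →
               Holds (outer (w i j) ∼ outer (v i)) × Holds (outer (w i j) ∼ outer (v j))
      common i≁j (inj₁ ij)            = contradiction (inj₁ ij) i≁j
      common i≁j (inj₂ (z , iz , zj)) = Product.map inj₁ inj₁ (commonNeighbour-spec iz zj)
    check Γ (star p r) = do
      f ← recheck (addLiteral Γ (centre p ∼ outer p) ▷ addStars p (literals Γ) _) r
      just λ Γ✓ → f (centre-adjacent p , proj₁ Γ✓) Γ✓
    check Γ (P₆ a b c d e f r)  = refute Γ true no-P₆ (a ∷ b ∷ c ∷ d ∷ e ∷ f ∷ []) r
    check Γ (House a b c d e r) = refute Γ false no-house (a ∷ b ∷ c ∷ d ∷ e ∷ []) r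

    recheck : ∀ {Γ A} → Extension Γ A → Refutation → Maybe (A → Contradictory Γ)
    recheck (Δ , p) r = Maybe.map (λ f a → f ∘ p a) (check Δ r)

    assume : ∀ Γ l → Refutation → Maybe (Holds l → Contradictory Γ)
    assume Γ l = recheck (addLiteral Γ l)

    refute : ∀ Γ {k} s → (∀ (xs : Vec Point k) → ¬ All Holds (chain s xs)) →
             Vec Point k → Refutation → Maybe (Contradictory Γ)
    refute Γ s ¬chain xs r with unproved Γ (chain s xs)
    ... | []          , p = just λ Γ✓ → ¬chain xs (p Γ✓ [])
    ... | l ∷ []      , p = do
      f ← assume Γ (negate l) r
      just λ Γ✓ → [ (λ h → ¬chain xs (p Γ✓ (h ∷ []))) , flip f Γ✓ ]′ (holds? l)
    ... | _           , _ = nothing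

-- The two configurations and their certificates.

-- The literal in the first line says that v 1 and v 3 have different dominators.
initialFacts : List (ℕ × ℕ) → List (ℕ × ℕ) → Facts
initialFacts fs cs = facts
  ((centre (v 3) ≁ outer (v 1)) ∷ map (λ (i , j) → outer (v i) ≁ outer (v j)) fs)
  (map (λ (i , j) → outer (v i) , outer (v j)) fs)
  cs

pentagon : Facts
pentagon = initialFacts
  ((0 , 1) ∷ (1 , 2) ∷ (2 , 3) ∷ (3 , 4) ∷ (0 , 4) ∷ [])
  ((1 , 3) ∷ (1 , 4) ∷ (2 , 4) ∷ (0 , 2) ∷ (0 , 3) ∷ [])

-- Six consecutive vertices of an antihole of length at least seven. The ends `v 0` and `v 5` are
-- then not cyclically consecutive, so they are close and the far pairs form a path.
copath : Facts
copath = initialFacts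
  ((0 , 1) ∷ (1 , 2) ∷ (2 , 3) ∷ (3 , 4) ∷ (4 , 5) ∷ [])
  ((0 , 2) ∷ (0 , 3) ∷ (0 , 4) ∷ (0 , 5) ∷ (1 , 3) ∷ (1 , 4) ∷ (1 , 5) ∷ (2 , 4) ∷ (2 , 5) ∷
   (3 , 5) ∷ [])

v0 v1 v2 v3 v4 v5 w02 w03 w04 w05 w13 w14 w15 w24 w25 d0 d03 d1 d2 d3 d4 : Point
v0 = outer (v 0)
v1 = outer (v 1)
v2 = outer (v 2)
v3 = outer (v 3)
v4 = outer (v 4)
v5 = outer (v 5)
w02 = outer (w 0 2)
w03 = outer (w 0 3)
w04 = outer (w 0 4)
w05 = outer (w 0 5)
w13 = outer (w 1 3)
w14 = outer (w 1 4)
w15 = outer (w 1 5)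
w24 = outer (w 2 4)
w25 = outer (w 2 5)
d0 = centre (v 0)
d03 = centre (w 0 3)
d1 = centre (v 1)
d2 = centre (v 2)
d3 = centre (v 3)
d4 = centre (v 4)

-- The opening stars make `d1`, `d2`, `d3` pairwise far: `d1` and `d3` by the initial literal, the
-- other pairs because consecutive `v i` are far. The parenthesised branch of each `split` is the
-- adjacent case; the text after it continues with the nonadjacent one.
pentagon-refutation : Refutation
pentagon-refutation =
  star (v 1) $ star (v 2) $ star (v 3) $
  split v2 v4
    (split v1 v3
       (witness 0 2 $ witness 0 3 $ P₆ v1 v3 w03 v0 w02 v2 $ P₆ v1 v3 w03 w02 v2 v4 ■) $
     witness 1 3 $ witness 1 4 $ P₆ v2 v4 w14 v1 w13 v3 $ P₆ v0 v3 w13 w14 v4 v2 $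
     split d3 w14
       (P₆ v3 d3 w14 v4 v2 d2 $ witness 0 2 $ P₆ v0 w02 v2 v4 w14 v1 $ witness 0 3 $
        P₆ v3 w03 v0 w02 v2 v4 $
        split d3 v0 (P₆ v3 d3 v0 w02 v2 v4 $ P₆ d1 v1 w14 w02 v2 d2 ■) $
        star (v 0) $
        split w14 w03
          (P₆ v2 v4 w14 w03 v0 d0 $ P₆ v4 v2 w02 w03 v3 d3 $ P₆ d0 v0 w02 w14 v1 d1 ■) $
        P₆ v0 w03 v3 d3 w14 v1 $ P₆ v0 w03 d3 w14 v4 v2 ■) $
     P₆ v2 v4 w14 w13 v3 d3 $ P₆ v0 d3 w13 w14 v4 v2 $ witness 0 3 $
     split d2 v0 (P₆ v3 w03 v0 d2 v2 v4 $ P₆ v0 w03 v3 w13 v1 d1 $ P₆ v1 w13 w03 d2 v2 v4 ■) $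
     star (v 0) $
     split w13 w03
       (P₆ v0 w03 w13 w14 v4 v2 $ P₆ v2 v4 w14 w03 v3 d3 $ P₆ d0 v0 w03 w13 v1 d1 ■) $
     P₆ v0 w03 v3 w13 v1 d1 $ P₆ v1 w13 v3 w03 v0 d0 ■) $
  witness 2 4 $
  split v1 v4
    (split v0 v2
       (witness 1 3 $ witness 0 3 $ P₆ v0 w03 v3 w13 v1 v4 $ P₆ v2 v0 w03 w13 v1 v4 ■) $
     witness 0 2 $ P₆ v0 w02 v2 w24 v4 v1 $ P₆ v1 v4 w24 w02 v0 v3 $ witness 1 3 $
     P₆ v2 w24 v4 v1 w13 v3 $ witness 0 3 $ P₆ v0 w03 v3 w13 v1 v4 $
     split w24 w03
       (split d3 w24
          (P₆ v3 d3 w24 v4 v1 d1 $ P₆ v0 d2 v2 w24 v4 v1 $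
           split d3 v0 (P₆ v0 d3 v3 w13 v1 v4 $ P₆ d1 v1 w13 w24 v2 d2 ■) $
           star (v 0) $ P₆ v1 v4 w24 w02 v0 d0 $ P₆ v1 v4 w24 w03 v0 d0 $
           P₆ v2 w02 v0 w03 v3 d3 $ P₆ d2 v2 w02 w03 v3 d3 ■) $
        P₆ v1 v4 w24 w02 d3 v3 $ P₆ v1 v4 w24 w03 v3 d3 $ P₆ v1 v4 w24 w02 v0 d3 $
        split d2 v0
          (P₆ v0 d2 v2 w24 v4 v1 $ P₆ v1 w13 w03 v0 d2 v2 $ P₆ v0 d2 w24 v4 v1 d1 $
           P₆ d1 v4 w24 w13 v3 d3 ■) $
        star (v 0) $ P₆ v1 v4 w24 w03 v0 d0 $ P₆ v4 v1 w13 w03 v0 d0 $ P₆ d1 v1 w13 w24 v2 d2 ■) $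
     P₆ v1 v4 w24 w02 v0 w03 $ P₆ v1 v4 w24 w02 w03 v3 ■) $
  witness 1 4 $
  split v1 v3
    (P₆ v2 w24 v4 w14 v1 v3 $ P₆ v0 v2 w24 w14 v1 v3 $
     split d2 w14 (P₆ v2 d2 w14 v1 v3 d3 ■) $
     P₆ v3 v1 w14 w24 v2 d2 $ P₆ v0 d2 w24 w14 v1 v3 $ P₆ v2 w24 w14 v1 v3 d3 $ witness 0 2 $
     split w14 w02
       (P₆ v3 v1 w14 w02 v2 d2 $ P₆ v1 v3 d3 v0 w02 v2 $ star (v 0) $ P₆ v3 v1 w14 w02 v0 d0 ■) $
     P₆ v0 w02 v2 w24 w14 v1 $ P₆ v0 w02 w24 w14 v1 v3 ■) $
  witness 1 3 $
  split v0 v2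
    (P₆ v0 v2 w24 v4 w14 v1 $
     split w13 w24
       (split d1 w24
          (P₆ v1 d1 w24 v2 v0 d3 $ P₆ v0 v2 w24 w13 v3 d3 $ witness 0 3 $
           P₆ v1 w13 v3 w03 v0 v2 $ P₆ v3 w03 v0 v2 w24 v4 $ P₆ v2 v0 w03 w13 v1 d1 $
           P₆ d2 v2 w24 w03 v3 d3 ■) $
        P₆ v0 v2 w24 v4 d1 v1 $ P₆ v0 v2 w24 w13 v1 d1 $ P₆ v0 v2 w24 w14 v1 d1 $
        P₆ v4 w14 v1 w13 v3 d3 $ P₆ v2 d2 v4 w14 w13 v3 $ star (v 4) $ P₆ d3 v3 w13 w14 v4 d4 ■) $
     P₆ v0 v2 w24 w14 v1 w13 $ P₆ v0 v2 w24 w14 w13 v3 ■) $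
  witness 0 2 $
  split v0 v3
    (P₆ v0 v3 w13 v1 w14 v4 $ P₆ v1 w13 v3 v0 w02 v2 $ P₆ v3 v0 w02 v2 w24 v4 $
     split w13 w24
       (split d2 w13
          (P₆ v0 v3 w13 v1 d1 v4 $
           split d2 v4
             (P₆ v3 v0 w02 v2 d2 v4 $ P₆ v4 d2 w02 v0 v3 d3 $ P₆ d1 v1 w13 w02 v0 d3 ■) $
           star (v 4) $ P₆ v0 v3 w13 w14 v4 d4 $ P₆ v0 v3 w13 w24 v4 d4 $
           P₆ v1 w14 v4 w24 v2 d2 $ P₆ d1 v1 w14 w24 v2 d2 ■) $
        P₆ v1 w13 v3 v0 d2 v2 $ P₆ v0 v3 w13 w14 d2 v2 $ P₆ v0 v3 w13 w24 v2 d2 $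
        P₆ v0 v3 w13 w14 v4 d2 $
        split d1 v4
          (P₆ v0 v3 w13 v1 d1 v4 $ P₆ v0 w02 w24 v4 d1 v1 $ P₆ d2 v2 w02 w13 v3 d3 ■) $
        star (v 4) $ P₆ v0 v3 w13 w24 v4 d4 $ P₆ v3 v0 w02 w24 v4 d4 $ P₆ v4 d4 w02 v0 v3 d3 $
        P₆ d1 v1 w13 w02 v0 d3 ■) $
     P₆ v0 v3 w13 w14 v4 w24 $ P₆ v0 v3 w13 w14 w24 v2 ■) $
  witness 0 3 $
  -- From here on no two of the `v i` are adjacent, and all five common neighbours are available.
  -- The next splits ask which dominators are shared.
  split d2 v0
    (split d1 w24 (P₆ v0 d2 v2 w24 d1 v1 ■) $
     split d1 v4 (P₆ v0 d2 v2 w24 v4 d1 $ P₆ v0 d2 w24 v4 d1 v1 ■) $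
     star (v 4) $
     split d2 w03
       (split d2 w24 (P₆ v3 w03 d2 w24 v4 d4 $ P₆ d3 v3 w03 w24 v4 d4 ■) $
        P₆ v3 w03 d2 v2 w24 v4 $
        split w14 w24
          (P₆ v0 d2 v2 w24 w14 v1 $ P₆ v0 w03 w24 w14 v1 d1 $ P₆ d1 v1 w14 w03 v3 d3 ■) $
        P₆ v0 d2 v2 w24 v4 w14 $ P₆ v2 w24 v4 w14 v1 d1 ■) $
     split d2 w13
       (split d4 w14
          (P₆ v2 w24 v4 w14 v1 d1 $ P₆ v0 d2 v2 w24 w14 v1 $ P₆ v0 d2 w24 w14 v1 d1 ■) $
        P₆ v3 w13 v1 w14 v4 d4 $ P₆ v0 d2 w13 w14 v4 d4 $ P₆ d3 v3 w13 w14 v4 d4 ■) $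
     P₆ v1 w13 v3 w03 v0 d2 $ P₆ v1 w13 w03 v0 d2 v2 ■) $
  split d3 v0
    (split d1 v4
       (split d3 w13 (P₆ v0 d3 w13 v1 d1 v4 ■) $
        P₆ v0 d3 v3 w13 v1 d1 $ P₆ v0 d3 v3 w13 d1 v4 ■) $
     split d2 v4
       (split d3 w02 (P₆ v3 d3 w02 v2 d2 v4 ■) $
        P₆ v3 d3 v0 w02 v2 d2 $ P₆ v3 d3 v0 w02 d2 v4 ■) $
     star (v 4) $
     split d1 w13
       (split d3 w14
          (split d3 w02 (P₆ v1 w14 d3 w02 v2 d2 $ P₆ d1 v1 w14 w02 v2 d2 ■) $
           split d3 w24 (P₆ v1 w14 v4 w24 v2 d2 $ P₆ d1 v1 w14 w24 v2 d2 ■) $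
           P₆ v3 d3 v0 w02 v2 w24 $ P₆ v3 d3 v0 w02 w24 v4 ■) $
        P₆ v0 d3 v3 w13 v1 w14 $ P₆ v0 d3 v3 w13 w14 v4 ■) $
     split d2 w13 (P₆ v0 d3 v3 w13 v1 d1 ■) $
     split d3 w13
       (split d3 w02 (P₆ v1 w13 d3 w02 v2 d2 $ P₆ d1 v1 w13 w02 v2 d2 ■) $
        P₆ v3 d3 v0 w02 v2 d2 $
        split w24 w02
          (P₆ v3 d3 v0 w02 w24 v4 $ P₆ v1 w13 d3 w24 v2 d2 $ P₆ d1 v1 w13 w24 v2 d2 ■) $
        P₆ v0 w02 v2 w24 v4 d4 $ P₆ v3 d3 v0 w02 v2 w24 ■) $
     split d4 w13 (P₆ v0 d3 v3 w13 v1 d1 ■) $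
     star (w 1 3) $ P₆ v0 d3 v3 w13 v1 d1 ■) $
  star (v 0) $
  split d1 v4
    (split d1 w13
       (split d1 w24 (P₆ v2 w24 d1 w13 v3 d3 $ P₆ d2 v2 w24 w13 v3 d3 ■) $
        split d1 w02 (P₆ v0 w02 d1 w13 v3 d3 $ P₆ d0 v0 w02 w13 v3 d3 ■) $
        P₆ v0 w02 v2 w24 v4 d1 $ P₆ v0 w02 w24 v4 d1 v1 ■) $
     split d1 w03
       (split d1 w24 (P₆ v0 w03 d1 w24 v2 d2 $ P₆ d0 v0 w03 w24 v2 d2 ■) $
        split d1 w02 (P₆ v2 w02 v0 w03 v3 d3 $ P₆ d2 v2 w02 w03 v3 d3 ■) $
        P₆ v0 w02 v2 w24 v4 d1 $ P₆ v0 w02 w24 v4 d1 v1 ■) $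
     P₆ v0 w03 v3 w13 v1 d1 $ P₆ v0 w03 w13 v1 d1 v4 ■) $
  split d2 v4
    (split d2 w02
       (split d2 w14 (P₆ v0 w02 d2 w14 v1 d1 $ P₆ d0 v0 w02 w14 v1 d1 ■) $
        P₆ v2 d2 v4 w14 v1 d1 $
        split w13 w14
          (P₆ v2 d2 v4 w14 w13 v3 $ P₆ v0 w02 d2 w13 v1 d1 $ P₆ d0 v0 w02 w13 v1 d1 ■) $
        P₆ v2 d2 v4 w14 v1 w13 $ P₆ v4 w14 v1 w13 v3 d3 ■) $
     P₆ v3 d3 w02 v2 d2 v4 $
     split w02 w03
       (P₆ v3 w03 w02 v2 d2 v4 $
        split d2 w14 (P₆ v0 w03 d2 w14 v1 d1 $ P₆ d0 v0 w03 w14 v1 d1 ■) $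
        split d2 w13 (P₆ v0 w03 v3 w13 v1 d1 $ P₆ d0 v0 w03 w13 v1 d1 ■) $
        P₆ v2 d2 v4 w14 v1 w13 $ P₆ v2 d2 v4 w14 w13 v3 ■) $
     P₆ v2 w02 v0 w03 v3 d3 $ P₆ v3 w03 v0 w02 v2 d2 ■) $
  star (v 4) $
  -- The centres of all five `v i` are now pairwise far.
  split d1 w13
    (split d4 w14
       (P₆ v4 w14 v1 w13 v3 d3 $
        split w14 w24
          (split d3 w24 (P₆ v3 d3 w24 w14 v1 d1 ■) $
           P₆ v2 w24 w14 w13 v3 d3 $ P₆ d2 v2 w24 w13 v3 d3 $ P₆ d3 v3 w13 w24 v4 d4 ■) $
        P₆ v1 w14 v4 w24 v2 d2 $ P₆ v2 w24 v4 w14 v1 d1 ■) $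
     P₆ v3 w13 v1 w14 v4 d4 $ P₆ d3 v3 w13 w14 v4 d4 $
     split w14 w03
       (split w14 w02
          (split d3 w02 (P₆ d0 v0 w02 w14 v1 d1 ■) $
           P₆ v3 d3 w14 w02 v0 d0 $ P₆ v3 d3 w14 w02 v2 d2 ■) $
        P₆ v0 w02 d1 v1 w14 v4 $ P₆ v0 w02 d4 v4 w14 v1 $ P₆ v1 w14 w03 v0 w02 v2 $
        P₆ v2 w02 w03 w14 v1 d1 $ P₆ v2 w02 w03 w14 v4 d4 ■) $
     P₆ v0 w03 v3 d3 w14 v1 $ P₆ v0 w03 d3 w14 v1 d1 ■) $
  split d2 w13
    (split d0 w03
       (split d2 w02 (P₆ v0 w02 d2 w13 v1 d1 $ P₆ d0 v0 w02 w13 v1 d1 ■) $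
        P₆ v0 w02 v2 d2 w13 v1 $ P₆ v3 w03 v0 w02 v2 d2 $ P₆ d2 v2 w02 w03 v3 d3 $
        P₆ d0 v0 w02 w13 v1 d1 ■) $
     P₆ v1 w13 v3 w03 v0 d0 $ P₆ v2 d2 w13 w03 v0 d0 $ P₆ d0 v0 w03 w13 v1 d1 ■) $
  split d3 w13
    (split d1 w03
       (split w24 w03
          (split d1 w24 (P₆ d0 v0 w03 w24 v2 d2 ■) $
           P₆ v1 d1 w03 w24 v2 d2 $ P₆ v1 d1 w03 w24 v4 d4 ■) $
        P₆ v0 w03 v3 d3 w24 v2 $ P₆ v2 w24 d0 v0 w03 v3 $
        split w14 w03
          (P₆ v0 w03 w14 v4 w24 v2 $ P₆ v2 w24 w14 w03 v0 d0 $ P₆ v2 w24 w14 w03 v3 d3 ■) $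
        P₆ v0 w03 d1 v1 w14 v4 $ P₆ v0 w03 d1 w14 v4 d4 ■) $
     P₆ v0 w03 v3 w13 v1 d1 $ P₆ v2 d2 w03 w13 v1 d1 $ P₆ d0 v0 w03 w13 v1 d1 $
     split w02 w03
       (split d1 w02 (P₆ v1 d1 w02 w03 v3 d3 ■) $
        P₆ v2 w02 w03 w13 v1 d1 $ P₆ d0 v0 w02 w13 v1 d1 $ P₆ d1 v1 w13 w02 v2 d2 ■) $
     P₆ v2 w02 v0 w03 v3 d3 $ P₆ v3 w03 v0 w02 v2 d2 ■) $
  split d0 w13
    (split w13 w02
       (split w13 w24
          (split d2 w24 (P₆ v0 d0 w13 w24 v4 d4 ■) $
           P₆ v0 d0 w13 w24 v2 d2 $ P₆ d1 v1 w13 w24 v2 d2 ■) $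
        P₆ v1 w13 v3 d3 w24 v2 $ P₆ v1 w13 w02 v2 w24 v4 $ P₆ v2 w24 d1 v1 w13 v3 $
        P₆ v4 w24 w02 w13 v1 d1 $ P₆ v4 w24 w02 w13 v3 d3 ■) $
     P₆ v1 w13 d0 v0 w02 v2 $ P₆ v1 w13 d0 w02 v2 d2 ■) $
  split d4 w13
    (split w13 w24
       (split w13 w02
          (split d2 w02 (P₆ v4 d4 w13 w02 v0 d0 ■) $
           P₆ v4 d4 w13 w02 v2 d2 $ P₆ d1 v1 w13 w02 v2 d2 ■) $
        P₆ v0 w02 v2 w24 w13 v1 $ P₆ v0 w02 d1 v1 w13 v3 $ P₆ v0 w02 d3 v3 w13 v1 $
        P₆ v0 w02 w24 w13 v1 d1 $ P₆ v0 w02 w24 w13 v3 d3 ■) $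
     P₆ v1 w13 d4 v4 w24 v2 $ P₆ v1 w13 d4 w24 v2 d2 ■) $
  star (w 1 3) $
  split d1 w02 (P₆ v0 w02 d1 v1 w13 v3 $ P₆ d0 v0 w02 w13 v3 d3 ■) $
  split w13 w02 (P₆ d0 v0 w02 w13 v1 d1 $ P₆ d1 v1 w13 w02 v2 d2 ■) $
  P₆ v0 w02 d3 v3 w13 v1 $
  split w14 w02
    (P₆ v0 w02 w14 v1 w13 v3 $ P₆ v0 w02 w14 w13 v3 d3 $ P₆ v3 d3 w14 w02 v0 d0 $
     P₆ v3 d3 w14 w02 v2 d2 ■) $
  split w24 w02
    (P₆ v0 w02 w24 v4 w14 v1 $
     split w13 w24 (P₆ v0 w02 w24 w13 v1 d1 $ P₆ v0 w02 w24 w13 v3 d3 ■) $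
     P₆ v0 w02 w24 w14 v1 w13 $ P₆ v0 w02 w24 w14 w13 v3 ■) $
  P₆ v0 w02 v2 w24 v4 w14 $ P₆ v0 w02 v2 w24 w14 v1 ■

copath-refutation : Refutation
copath-refutation =
  star (v 1) $ star (v 2) $ star (v 3) $
  split v0 v3
    (witness 0 4 $ witness 1 3 $
     split v1 v4
       (witness 1 5 $ witness 2 4 $ P₆ v2 w24 v4 v1 w13 v3 $
        split v0 v5
          (split v2 v5
             (P₆ v0 v5 v2 w24 v4 v1 $ P₆ v1 w13 v3 v0 v5 v2 $
              split d3 w24
                (P₆ v3 v0 w24 v4 v1 d1 $ House v1 w24 d1 w13 v4 $ P₆ v4 v1 w13 v5 v2 d2 $
                 House v2 w13 d2 w24 v5 ■) $
              P₆ v1 v4 w24 v0 v3 d3 $ P₆ v1 v4 w24 v2 v5 d3 $ P₆ v4 v1 w13 v5 v0 d3 $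
              P₆ v0 v3 w13 v1 v4 d2 $ P₆ v4 v1 w13 v5 v2 d2 $ P₆ v1 v4 w24 v0 v5 d2 $
              P₆ v3 v0 w24 v4 v1 d1 $ House v1 w24 d1 w13 v4 ■) $
           witness 2 5 $ P₆ v1 v4 w24 v2 w25 v5 $ P₆ v2 w24 v4 v1 w15 v5 $
           P₆ v2 w25 v5 w15 v1 v4 $ House w24 v1 w25 v4 w15 ■) $
        witness 0 5 $ P₆ v0 w04 v4 v1 w15 v5 $ P₆ v0 w05 v5 w15 v1 v4 $ P₆ v1 v4 w04 v0 w05 v5 $
        House w04 v1 w05 v4 w15 ■) $
     witness 1 4 $ P₆ v0 v3 w13 v1 w14 v4 $ P₆ v1 w13 v3 v0 w04 v4 $ P₆ v1 w14 v4 w04 v0 v3 $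
     House w13 v0 w14 v3 w04 ■) $
  witness 0 3 $
  -- With `v 0` and `v 3` nonadjacent, the outermost cases ask which of `d1`, `d2`, `d3` dominates
  -- `w03`. If none does, its centre `d03` is a fourth one far from these three.
  split d1 w03
    (split v0 v4
       (witness 1 4 $
        split v1 v3
          (split v0 v2
             (P₆ v2 v0 v4 w14 v1 v3 $ P₆ v2 v0 w03 v3 v1 w14 $ House v0 w14 v2 w03 v4 ■) $
           witness 0 2 $ P₆ v1 v3 w03 v0 v4 v2 $ P₆ v1 v3 w03 v0 w02 v2 $
           P₆ v1 v3 w03 w02 v2 d2 $ P₆ v1 v3 d3 v0 w02 v2 $ P₆ v0 v4 w14 v1 v3 d3 $
           P₆ v0 w03 d1 v1 w14 d3 $ House w14 v3 w02 v1 w03 $ P₆ v1 w14 v4 v0 w02 v2 $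
           P₆ v2 w02 v4 w14 v1 v3 ■) $
        witness 1 3 $ P₆ v0 v4 w14 v1 w13 v3 $ P₆ v1 w13 v3 w03 v0 v4 $ P₆ v1 w14 v4 v0 w03 v3 $
        House w14 v0 w13 v4 w03 ■) $
     witness 0 4 $
     split v1 v5
       (witness 1 4 $ P₆ v0 w04 v4 w14 v1 v5 $ witness 0 5 $ P₆ v0 w05 v5 v1 w14 v4 $
        P₆ v1 v5 w05 v0 w04 v4 $ House w14 v5 w04 v1 w05 ■) $
     witness 1 5 $
     split v1 v3
       (P₆ v1 v3 w03 v0 w04 v4 $ witness 1 4 $ P₆ v0 w03 v3 v1 w14 v4 $ P₆ v0 w04 v4 w14 v1 v3 $
        House w14 v3 w04 v1 w03 ■) $
     witness 1 3 $
     split v1 v4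
       (P₆ v1 v4 w04 v0 w03 v3 $ P₆ v4 v1 d1 w03 v3 d3 $ P₆ v1 v4 w04 w03 v3 d3 $
        House v4 w03 v1 w04 d1 ■) $
     witness 1 4 $
     split v2 v4
       (P₆ v2 v4 w14 v1 w15 v5 $ witness 2 5 $ P₆ v1 w14 v4 v2 w25 v5 $ P₆ v1 w15 v5 w25 v2 v4 $
        House w14 v2 w15 v4 w25 ■) $
     witness 2 4 $
     split v0 v2
       (P₆ v1 d1 w03 v0 v2 d2 $ P₆ v1 w13 v3 w03 v0 v2 $ P₆ v4 d2 v0 w03 v3 d3 $
        House v0 w13 v2 w03 d2 $ House w13 d1 v3 v1 w03 $
        split d3 w04 (P₆ v1 d1 w03 v0 w04 d3 $ House w03 d3 v0 v3 w04 ■) $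
        P₆ v4 w04 v0 w03 v3 d3 $
        split d1 v4
          (House w03 v4 v0 d1 w04 $ P₆ v0 w04 d1 w13 v3 d3 $ P₆ d2 v0 w04 w13 v3 d3 ■) $
        star (v 4) $ P₆ d3 v3 w03 w04 v4 d4 $ P₆ v1 d1 w03 w04 v2 d2 $ P₆ d2 v0 w04 w13 v3 d3 $
        P₆ v1 w14 v4 w04 v0 v2 $ P₆ v0 w04 w14 v1 w13 v3 $ P₆ v2 v0 w04 w14 w13 v3 ■) $
     witness 0 2 $ P₆ v1 d1 w03 v0 d2 v2 $
     split d3 v0
       (split w13 w03 (House v3 v0 w13 d3 w03 $ House w13 d1 v3 v1 w03 ■) $
        House v3 v0 w13 w03 d3 $ House d1 v3 v1 w03 w13 $ P₆ v0 d3 v3 w13 v1 d1 ■) $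
     star (v 0) $ P₆ v4 d0 v0 w03 v3 d3 $
     split d1 v4
       (split w03 w04
          (House w03 v4 v0 d1 w04 $
           split d1 w13 (P₆ v0 w04 d1 w13 v3 d3 $ P₆ d0 v0 w04 w13 v3 d3 ■) $
           P₆ v0 w04 d1 v1 w13 v3 $ House d1 w13 v4 v1 w04 ■) $
        P₆ v4 w04 v0 w03 v3 d3 $ P₆ v1 d1 v4 w04 v0 d0 ■) $
     split d2 v4
       (split w14 w03 (P₆ v0 w03 w14 v4 d2 v2 $ P₆ v2 d2 w14 w03 v0 d0 ■) $
        P₆ v0 w03 d1 v1 w14 v4 $ P₆ v0 w03 d1 w14 v4 d2 ■) $
     star (v 4) $
     split w03 w04
       (House w03 d3 v0 v3 w04 $ P₆ d3 v3 w03 w04 v4 d4 $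
        split w14 w03
          (House w03 v4 v0 w14 w04 $ House w14 v0 v4 d0 w04 $ House w14 d1 w04 v1 w03 $
           P₆ d0 v0 w03 w14 v4 d4 ■) $
        P₆ v0 w03 d1 v1 w14 v4 $ P₆ v0 w03 d1 w14 v4 d4 ■) $
     P₆ v1 d1 w03 v0 w04 v4 $ P₆ v3 w03 v0 w04 v4 d4 ■) $
  split d2 w03
    (P₆ v2 d2 w03 v3 v1 d1 $ witness 1 3 $
     split w13 w03
       (split v0 v4
          (P₆ v1 d1 v4 v0 w03 v3 $ P₆ v4 v0 w03 w13 v1 d1 $ P₆ v1 w13 v3 d3 v0 v4 $
           witness 1 4 $ P₆ v0 v4 w14 v1 w13 v3 $ P₆ v0 v4 w14 w13 v3 d3 $
           House w13 d3 v1 v3 w14 ■) $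
        witness 0 4 $
        split v1 v4
          (P₆ v0 w04 v4 v1 w13 v3 $ P₆ v1 v4 w04 v0 w03 v3 $ House w13 v4 w03 v1 w04 ■) $
        witness 1 4 $
        split d1 w14
          (split d1 v4
             (P₆ v0 w03 w13 v1 d1 v4 $ P₆ v1 d1 v4 v2 d2 w03 $ P₆ v2 d2 w03 w13 d1 v4 ■) $
           split d2 v4
             (P₆ v1 w14 v4 d2 w03 v3 $ P₆ v2 v4 w14 w03 v3 d3 $ House w13 w14 v3 v1 w03 $
              P₆ v2 d2 v4 w14 w13 v3 $ House w13 v4 v1 d2 w14 ■) $
           star (v 4) $ P₆ v3 w03 d2 v2 v4 d4 $ P₆ d3 v3 w03 w14 v4 d4 $
           P₆ v0 w03 w13 v1 w14 v4 $ P₆ v1 w14 v4 d4 v0 w03 $ P₆ v0 w03 w13 w14 v4 d4 $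
           P₆ v2 d2 w03 w13 w14 v4 ■) $
        split d2 w14 (P₆ v1 w14 d2 w03 v3 d3 $ P₆ d1 v1 w14 w03 v3 d3 ■) $
        split d3 w14 (P₆ v1 w14 d3 v3 w03 d2 $ P₆ v2 d2 w03 w14 v1 d1 ■) $
        star (w 1 4) $ P₆ v2 d2 w03 w14 v1 d1 $ P₆ v0 w03 w13 v1 w14 v4 $
        P₆ v1 w14 v4 d2 w03 v3 $ P₆ v1 w14 v4 v2 d2 w03 $ P₆ v2 d2 w03 w13 w14 v4 $
        P₆ v0 d3 v3 w13 v1 d1 $
        split w03 w04
          (P₆ v1 w14 v4 w04 w03 v3 $ House w03 d3 v0 v3 w04 $ P₆ v1 w14 w04 w03 v3 d3 ■) $
        P₆ v1 w14 v4 w04 v0 w03 $ P₆ v1 w14 w04 v0 w03 v3 ■) $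
     P₆ v0 w03 v3 w13 v1 d1 $ P₆ v1 w13 v3 w03 d2 v2 ■) $
  split d3 w03
    (split v1 v4
       (witness 1 3 $ P₆ v0 w03 v3 w13 v1 v4 $ witness 0 4 $ P₆ v0 w04 v4 v1 w13 v3 $
        P₆ v1 v4 w04 v0 w03 v3 $ House w13 v4 w03 v1 w04 ■) $
     witness 1 4 $
     split v0 v2
       (P₆ v2 v0 w03 v3 v1 d1 $ witness 1 3 $ P₆ v1 w13 v3 w03 v0 v2 $ P₆ v2 v0 w03 w13 v1 d1 $
        P₆ v1 w13 v3 d3 v0 v2 $ P₆ v1 w13 w03 v0 v2 d2 $
        split w14 w03
          (P₆ v2 v0 w03 w14 v1 d1 $ House w13 w14 v3 v1 w03 $ P₆ v0 v4 w14 w13 v3 d3 $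
           P₆ v2 v4 w14 w13 v3 d3 $ P₆ d2 v4 w14 w13 v3 d3 $ P₆ v2 v0 w03 w13 d1 v4 $
           star (v 4) $ P₆ v2 v0 w03 w14 v4 d4 ■) $
        P₆ v1 w14 v4 v0 w03 v3 $ P₆ v2 v0 w03 w13 v1 w14 $ P₆ v0 v2 v4 w14 w13 v3 $
        P₆ v2 v0 w03 w13 w14 v4 ■) $
     witness 0 2 $
     split v1 v3 (P₆ v1 v3 w03 v0 w02 v2 $ P₆ v1 v3 w03 w02 v2 d2 $ P₆ v2 w02 w03 v3 v1 d1 ■) $
     witness 1 3 $
     split d1 w13
       (split w13 w14
          (House w13 d3 v1 v3 w14 $ P₆ v2 v4 w14 w13 v3 d3 $ P₆ v2 d2 w14 w13 v3 d3 $
           P₆ v2 d2 v4 w14 w13 v3 $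
           split d2 v0 (P₆ v1 w13 v3 w03 v0 d2 $ P₆ v1 w13 w03 v0 d2 v2 ■) $
           split d3 v0 (P₆ v0 d3 v3 w13 w14 v4 $ P₆ v1 w13 v3 d3 v0 v4 ■) $
           star (v 0) $ P₆ v0 v4 w14 w13 v3 d3 $ P₆ v0 d0 w14 w13 v3 d3 $
           P₆ v1 w13 v3 w03 v0 d0 $ P₆ v0 d0 v4 w14 w13 v3 $ P₆ v4 d1 w13 w03 v0 d0 $
           P₆ v4 w14 w13 w03 v0 d0 $ P₆ d0 v0 w03 w14 v1 d1 $ star (v 4) $
           P₆ d0 v0 w03 w14 v4 d4 ■) $
        P₆ v4 w14 v1 w13 v3 d3 $ P₆ v4 w14 d3 v3 w13 d1 $ House v1 v4 w13 w14 d1 ■) $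
     P₆ v0 w03 v3 w13 v1 d1 $
     split d2 v0 (P₆ v1 w13 w03 v0 d2 v2 $ House w13 v0 v3 d2 w03 ■) $
     split d3 v0
       (P₆ v0 d3 v3 w13 v1 d1 $
        split w13 w02 (House d3 w02 v3 v0 w13 $ P₆ d1 v1 w13 w02 v2 d2 ■) $
        P₆ v1 w13 d3 v0 w02 v2 $ P₆ v1 w13 d3 w02 v2 d2 ■) $
     star (v 0) $ P₆ d0 v0 w03 w13 v1 d1 $ House w13 v0 v3 d0 w03 ■) $
  star (w 0 3) $
  split v1 v3
    (P₆ v2 v0 w03 v3 v1 d1 $ witness 0 2 $ P₆ v1 v3 w03 v0 w02 v2 $ P₆ v1 v3 w03 w02 v2 d2 $
     P₆ v2 w02 w03 v3 v1 d1 ■) $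
  witness 1 3 $
  split w13 w03
    (split v0 v4
       (P₆ v1 d1 v4 v0 w03 v3 $ P₆ v4 v0 w03 w13 v1 d1 $ P₆ v1 w13 v3 d3 v0 v4 $ witness 1 4 $
        P₆ v0 v4 w14 v1 w13 v3 $ P₆ v0 v4 w14 w13 v3 d3 $ House w13 d3 v1 v3 w14 ■) $
     witness 0 4 $
     split w03 w04
       (split d3 w04
          (House w03 d3 v0 v3 w04 $ House v3 v0 w13 d3 w03 $ House w03 v4 v0 d03 w04 $
           split v1 v4 (P₆ v0 w04 v4 v1 w13 v3 $ House w13 v4 d3 v1 w04 ■) $
           witness 1 4 $ P₆ v0 d3 w13 v1 d1 v4 $ P₆ v4 w04 d3 w13 v1 d1 $
           P₆ d1 v1 w13 w04 v4 d2 $ star (v 4) $ P₆ d1 v1 w13 w04 v4 d4 ■) $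
        P₆ v1 v4 w04 w03 v3 d3 $ P₆ v1 d1 w04 w03 v3 d3 $ House v0 v3 w04 d3 w03 $
        P₆ v1 d1 v4 w04 w03 v3 $ witness 1 4 $
        split w14 w03
          (House w13 w14 v3 v1 w03 $ House w03 v4 v0 w14 w04 $ House w14 v3 w04 d3 w03 $
           P₆ v2 v4 w14 w03 v3 d3 $ P₆ v2 d2 w14 w03 v3 d3 $ P₆ d1 v1 w14 w03 v3 d3 $
           P₆ v2 d2 v4 w14 w03 v3 $
           split d03 v4 (House w13 v4 v1 d03 w14 $ House w14 d03 w13 v4 w03 ■) $
           star (v 4) $ P₆ d3 v3 w03 w14 v4 d4 ■) $
        P₆ v0 w03 v3 d3 w14 v1 $ P₆ v1 w14 v4 w04 w03 v3 $ P₆ v1 w14 w04 w03 v3 d3 ■) $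
     P₆ v1 v4 w04 v0 w03 v3 $ House w13 v0 v3 w04 w03 $ P₆ v1 w13 w03 v0 w04 v4 ■) $
  P₆ v0 w03 v3 w13 v1 d1 $
  split v1 v4 (P₆ v0 w03 v3 w13 v1 v4 ■) $
  witness 1 4 $ P₆ v1 w13 v3 w03 v0 v4 $ P₆ v0 w03 v3 w13 d1 v4 $
  split w13 w14 (P₆ v0 w03 v3 w13 w14 v4 $ House w13 w03 v1 v3 w14 ■) $
  P₆ v4 w14 v1 w13 v3 d3 $ P₆ v4 w14 d3 v3 w13 d1 ■

module _ (M : Model) where
  open Semantics M

  -- Success of `check` depends on names alone, so it evaluates with the model a variable, and one
  -- run covers every model.
  pentagon-contradictory : Contradictory pentagon
  pentagon-contradictory = from-just (check pentagon pentagon-refutation)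

  copath-contradictory : Contradictory copath
  copath-contradictory = from-just (check copath copath-refutation)

-- The cycle as arithmetic modulo m.

module _ {m : ℕ} .{{_ : NonZero m}} where

  toℕ-mod : ∀ i → toℕ (i mod m) ≡ i % m
  toℕ-mod i = toℕ-fromℕ< (m%n<n i m)

  suc-% : ∀ i → suc (i % m) % m ≡ suc i % m
  suc-% i = begin
    suc (i % m) % m           ≡⟨ %-distribˡ-+ 1 (i % m) m ⟩
    (1 % m + i % m % m) % m   ≡⟨ cong (λ r → (1 % m + r) % m) (m%n%n≡m%n i m) ⟩
    (1 % m + i % m) % m       ≡⟨ %-distribˡ-+ 1 i m ⟨
    suc i % m                 ∎
    where open ≡-Reasoning

  -- For the residue r of `i`, the sum g + r is below 2m. If it is below m, equality of residues
  -- forces g = 0; otherwise one m is subtracted and equality forces g = m.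
  shift-% : ∀ {g} → 0 < g → g < m → ∀ i → (g + i) % m ≢ i % m
  shift-% {g} 0<g g<m i eq with g + i % m <? m | reduced
    where
    reduced : (g + i % m) % m ≡ i % m
    reduced = begin
      (g + i % m) % m     ≡⟨ cong (λ r → (r + i % m) % m) (m<n⇒m%n≡m g<m) ⟨
      (g % m + i % m) % m ≡⟨ %-distribˡ-+ g i m ⟨
      (g + i) % m         ≡⟨ eq ⟩
      i % m               ∎
      where open ≡-Reasoning
  ... | yes small | e =
    ℕ.<⇒≢ 0<g (sym (ℕ.+-cancelʳ-≡ (i % m) g 0 (trans (sym (m<n⇒m%n≡m small)) e)))
  ... | no large  | e = ℕ.<⇒≢ g<m (ℕ.+-cancelʳ-≡ (i % m) g m g+r≡m+r)
    where
    m≤g+r = ℕ.≮⇒≥ large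
    wrapped : g + i % m ∸ m < m
    wrapped = ℕ.m<n+o⇒m∸n<o (g + i % m) m (ℕ.+-mono-< g<m (m%n<n i m))
    g+r≡m+r : g + i % m ≡ m + i % m
    g+r≡m+r = begin
      g + i % m                 ≡⟨ ℕ.m+[n∸m]≡n m≤g+r ⟨
      m + (g + i % m ∸ m)       ≡⟨ cong (m +_) (m<n⇒m%n≡m wrapped) ⟨
      m + (g + i % m ∸ m) % m   ≡⟨ cong (m +_) (m≤n⇒[n∸m]%m≡n%m m≤g+r) ⟩
      m + (g + i % m) % m       ≡⟨ cong (m +_) e ⟩
      m + i % m                 ∎
      where open ≡-Reasoning

  cycle⇒suc : ∀ {a b} → Adj (cycle m) a b →
              suc (toℕ a) % m ≡ toℕ b ⊎ suc (toℕ b) % m ≡ toℕ a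
  cycle⇒suc {a} {b} (inj₁ (inj₁ eq)) = inj₁ (trans (cong (_% m) eq) (m<n⇒m%n≡m (toℕ<n b)))
  cycle⇒suc {a} {b} (inj₁ (inj₂ eq)) = inj₂ (trans (cong (_% m) eq) (m<n⇒m%n≡m (toℕ<n a)))
  cycle⇒suc (inj₂ (_ , inj₁ (a≡0 , eq))) =
    inj₂ (trans (cong (_% m) eq) (trans (n%n≡0 m) (sym a≡0)))
  cycle⇒suc (inj₂ (_ , inj₂ (b≡0 , eq))) =
    inj₁ (trans (cong (_% m) eq) (trans (n%n≡0 m) (sym b≡0)))

  suc⇒cycle : ∀ {a b} → a ≢ b → suc (toℕ a) % m ≡ toℕ b → Adj (cycle m) a b
  suc⇒cycle {a} {b} a≢b eq with ℕ.m≤n⇒m<n∨m≡n (toℕ<n a)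
  ... | inj₁ a+1<m = inj₁ (inj₁ (trans (sym (m<n⇒m%n≡m a+1<m)) eq))
  ... | inj₂ a+1≡m =
    inj₂ (a≢b , inj₂ (trans (sym eq) (trans (cong (_% m) a+1≡m) (n%n≡0 m)) , a+1≡m))

  mod-distinct : ∀ {g} → 0 < g → g < m → ∀ i → i mod m ≢ (g + i) mod m
  mod-distinct {g} 0<g g<m i eq = shift-% 0<g g<m i
    (trans (sym (toℕ-mod (g + i))) (trans (cong toℕ (sym eq)) (toℕ-mod i)))

  cycle-successor : 1 < m → ∀ i → Adj (cycle m) (i mod m) (suc i mod m)
  cycle-successor 1<m i = suc⇒cycle (mod-distinct ℕ.z<s 1<m i) (begin
    suc (toℕ (i mod m)) % m ≡⟨ cong (λ r → suc r % m) (toℕ-mod i) ⟩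
    suc (i % m) % m         ≡⟨ suc-% i ⟩
    suc i % m               ≡⟨ toℕ-mod (suc i) ⟨
    toℕ (suc i mod m)       ∎)
    where open ≡-Reasoning

  -- An edge would make a shift by one less or one more than the gap trivial modulo m, and both of
  -- these lie strictly between 0 and m.
  cycle-chord : ∀ {g} → 2 ≤ g → suc g < m → ∀ i →
                Adj (complement (cycle m)) (i mod m) ((g + i) mod m)
  cycle-chord {suc g} (s≤s 1≤g) g+2<m i =
    mod-distinct ℕ.z<s (ℕ.<⇒≤ g+2<m) i , nonadjacent ∘ cycle⇒suc
    where
    open ≡-Reasoning
    nonadjacent : ¬ (suc (toℕ (i mod m)) % m ≡ toℕ (suc (g + i) mod m)
                     ⊎ suc (toℕ (suc (g + i) mod m)) % m ≡ toℕ (i mod m))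
    nonadjacent (inj₁ eq) = shift-% 1≤g (ℕ.<-trans (ℕ.n<1+n g) (ℕ.<⇒≤ g+2<m)) (suc i) (begin
      (g + suc i) % m               ≡⟨ cong (_% m) (ℕ.+-suc g i) ⟩
      suc (g + i) % m               ≡⟨ toℕ-mod (suc (g + i)) ⟨
      toℕ (suc (g + i) mod m)       ≡⟨ eq ⟨
      suc (toℕ (i mod m)) % m       ≡⟨ cong (λ r → suc r % m) (toℕ-mod i) ⟩
      suc (i % m) % m               ≡⟨ suc-% i ⟩
      suc i % m                     ∎)
    nonadjacent (inj₂ eq) = shift-% ℕ.z<s g+2<m i (begin
      suc (suc (g + i)) % m             ≡⟨ suc-% (suc (g + i)) ⟨
      suc (suc (g + i) % m) % m         ≡⟨ cong (λ r → suc r % m) (toℕ-mod (suc (g + i))) ⟨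
      suc (toℕ (suc (g + i) mod m)) % m ≡⟨ eq ⟩
      toℕ (i mod m)                     ≡⟨ toℕ-mod i ⟩
      i % m                             ∎)

-- Adjacency in the square as closeness.

square⇒close : ∀ {n} {G : Graph n} {x y} → Adj (square G) x y → Close G x y
square⇒close (inj₁ ((_ , xy , refl) , _))          = inj₁ xy
square⇒close (inj₂ ((z , xz , _ , zy , refl) , _)) = inj₂ (z , xz , zy)

-- A vertex with a neighbour is `Close` to itself, hence the assumption of distinctness.
close⇒square : ∀ {n} {G : Graph n} {x y} → x ≢ y → Close G x y → Adj (square G) x y
close⇒square {G = G} x≢y (inj₁ xy) = inj₁ ((_ , xy , refl) , λ { (s≤s z≤n) x≡y → x≢y x≡y })
close⇒square {G = G} {x} {y} x≢y (inj₂ (z , xz , zy)) with adj? G x y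
... | yes xy = close⇒square x≢y (inj₁ xy)
... | no ¬xy = inj₂ ((z , xz , y , zy , refl) ,
  λ { {zero} _ x≡y → x≢y x≡y
    ; {suc zero} _ (_ , xy , refl) → ¬xy xy
    ; {suc (suc _)} (s≤s (s≤s ())) })

-- The walk visits the positions 1, 3, 5 and so on. In the application its end `1 + k * 2` is the
-- cycle length, that is, position 0 again. Starting at 1 leaves room for a vertex before the three
-- with different dominators.
change-or-constant : ∀ {n} (L : ℕ → Fin n) k → (∃ λ t → L (1 + t) ≢ L (3 + t)) ⊎ L (1 + k * 2) ≡ L 1
change-or-constant L zero    = inj₂ refl
change-or-constant L (suc k) with L (1 + k * 2) ≟ L (3 + k * 2) | change-or-constant L k
... | no ≢₂  | _        = inj₁ (k * 2 , ≢₂)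
... | yes _  | inj₁ t   = inj₁ t
... | yes eq | inj₂ eq′ = inj₂ (trans (sym eq) eq′)

-- From an antihole of the square to a window.

theorem4 : ∀ (n : ℕ) (G : Graph n) → G FreeOf path 6 → G FreeOf house →
    ∃ (λ D → EfficientDominatingSet G D) → OddAntiholeFree (square G)
theorem4 n G path-free house-free (D , efficient) k 2≤k copy = refuted
  where
  m : ℕ
  m = 2 * k + 1

  m≡ : m ≡ 1 + k * 2
  m≡ = trans (ℕ.+-comm (2 * k) 1) (cong suc (ℕ.*-comm 2 k))

  5≤m : 5 ≤ m
  5≤m = ℕ.+-monoˡ-≤ 1 (ℕ.*-monoʳ-≤ 2 2≤k)

  instance
    m-nonZero : NonZero m
    m-nonZero = ℕ.>-nonZero (ℕ.<-≤-trans ℕ.z<s 5≤m)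

  u : ℕ → Fin n
  u i = vertex copy (i mod m)

  u-periodic : ∀ i → u (m + i) ≡ u i
  u-periodic i = cong (vertex copy) (toℕ-injective
    (trans (toℕ-mod (m + i))
      (trans (cong (_% m) (ℕ.+-comm m i)) (trans ([m+n]%n≡m%n i m) (sym (toℕ-mod i))))))

  u-close : ∀ {g} → 2 ≤ g → suc g < m → ∀ i → Close G (u i) (u (g + i))
  u-close 2≤g g+1<m i = square⇒close (to (induced copy _ _) (cycle-chord 2≤g g+1<m i))

  1<m : 1 < m
  1<m = ℕ.≤-trans (s≤s (s≤s z≤n)) 5≤m

  u-distinct : ∀ i → u i ≢ u (suc i)
  u-distinct i = mod-distinct ℕ.z<s 1<m i ∘ injective copy

  -- Closeness would give an edge of the square, hence by `induced` an edge of the complement of the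
  -- cycle, between cyclically consecutive vertices.
  u-not-close : ∀ i → ¬ Close G (u i) (u (suc i))
  u-not-close i c =
    proj₂ (from (induced copy _ _) (close⇒square (u-distinct i) c)) (cycle-successor 1<m i)

  dominator : Fin n → Fin n
  dominator x = proj₁ (efficient x)

  dominator-unique : ∀ {x y z} → Dominates G (dominator x) z → Dominates G (dominator y) z →
                     dominator x ≡ dominator y
  dominator-unique {x} {y} {z} xz yz =
    trans (sym (proj₂ (proj₂ (efficient z)) (proj₁ (proj₁ (proj₂ (efficient x))) , xz)))
          (proj₂ (proj₂ (efficient z)) (proj₁ (proj₁ (proj₂ (efficient y))) , yz))

  dominates : ∀ x → Dominates G (dominator x) x
  dominates x = proj₂ (proj₁ (proj₂ (efficient x)))

  -- A vertex dominated by both would join them by a walk of length at most two.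
  u-apart : ∀ i {z} → Dominates G (u i) z → ¬ Dominates G (u (suc i)) z
  u-apart i (inj₁ refl) (inj₁ eq)   = u-distinct i (sym eq)
  u-apart i (inj₁ refl) (inj₂ adj)  = u-not-close i (inj₁ (adj-sym G adj))
  u-apart i (inj₂ adj)  (inj₁ refl) = u-not-close i (inj₁ adj)
  u-apart i (inj₂ xz)   (inj₂ yz)   = u-not-close i (inj₂ (_ , xz , adj-sym G yz))

  dominators-differ : dominator (u 0) ≢ dominator (u 1)
  dominators-differ eq = u-apart 0 (Dominates-sym (dominates (u 0)))
    (Dominates-sym (subst (λ d → Dominates G d (u 1)) (sym eq) (dominates (u 1))))
    where
    Dominates-sym : ∀ {x y} → Dominates G x y → Dominates G y x
    Dominates-sym (inj₁ x≡y) = inj₁ (sym x≡y)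
    Dominates-sym (inj₂ xy)  = inj₂ (adj-sym G xy)

  -- The window starts one place before the three vertices with different dominators, so that these
  -- become `v 1`, `v 2`, `v 3`.
  module Window (t : ℕ) (distinct : dominator (u (1 + t)) ≢ dominator (u (3 + t))) where
    M : Model
    M = record
      { G = G ; path-free = path-free ; house-free = house-free
      ; dominator = dominator ; dominates = dominates
      ; unique = λ {x} {y} {z} → dominator-unique {x} {y} {z}
      -- With `t` added on the right, `suc i` denotes the vertex after that of `i` by computation.
      ; vertexAt = λ i → u (i + t) }

    open Semantics M
    open Doubled G

    FarAt : ℕ × ℕ → Set
    FarAt (i , j) = FarHolds (outer (v i) , outer (v j))

    far : ∀ i → FarAt (i , suc i)
    far i = (λ ij → u-apart (i + t) (~⇒dominates ij) (inj₁ refl)) ,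
            λ ir jr → u-apart (i + t) (~⇒dominates ir) (~⇒dominates jr)

    close : ∀ i g → {True (2 ≤? g)} → suc g < m → CloseHolds (i , g + i)
    close i g {2≤g} g+1<m =
      subst (λ j → Close G (u (i + t)) (u j)) (sym (ℕ.+-assoc g i t))
        (u-close (toWitness 2≤g) g+1<m (i + t))

    d₃≁v₁ : Holds (centre (v 3) ≁ outer (v 1))
    d₃≁v₁ adj = distinct (dominator-unique {u (1 + t)} (dominates (u (1 + t))) (~⇒dominates adj))

    valid : ∀ {fs cs} → All FarAt fs → All CloseHolds cs → Valid (initialFacts fs cs)
    valid ff cc = d₃≁v₁ ∷ map⁺ (All.map proj₁ ff) , map⁺ ff , cc

  pentagon-case : m ≡ 5 → ∃ (λ t → dominator (u (1 + t)) ≢ dominator (u (3 + t))) → ⊥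
  pentagon-case m≡5 (t , distinct) = pentagon-contradictory M (valid
    (far 0 ∷ far 1 ∷ far 2 ∷ far 3 ∷ wrapped ∷ [])
    (close′ 1 2 ∷ close′ 1 3 ∷ close′ 2 2 ∷ close′ 0 2 ∷ close′ 0 3 ∷ []))
    where
    open Window t distinct
    open Semantics M

    close′ : ∀ i g → {True (2 ≤? g)} → {True (suc g <? 5)} → CloseHolds (i , g + i)
    close′ i g {2≤g} {g<4} = close i g {2≤g} (subst (suc g <_) (sym m≡5) (toWitness g<4))

    v₅≡v₀ : u (5 + t) ≡ u t
    v₅≡v₀ = trans (cong (λ s → u (s + t)) (sym m≡5)) (u-periodic t)

    -- Position 5 is position 0 again, so the far pair (4, 5) closes the cycle.
    wrapped : FarAt (0 , 4)
    wrapped = Far-sym (subst (λ x → Far (u (4 + t) , true) (x , true)) v₅≡v₀ (far 4))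

  copath-case : 7 ≤ m → ∃ (λ t → dominator (u (1 + t)) ≢ dominator (u (3 + t))) → ⊥
  copath-case 7≤m (t , distinct) = copath-contradictory M (valid
    (far 0 ∷ far 1 ∷ far 2 ∷ far 3 ∷ far 4 ∷ [])
    (close′ 0 2 ∷ close′ 0 3 ∷ close′ 0 4 ∷ close′ 0 5 ∷ close′ 1 2 ∷ close′ 1 3 ∷ close′ 1 4 ∷
     close′ 2 2 ∷ close′ 2 3 ∷ close′ 3 2 ∷ []))
    where
    open Window t distinct
    open Semantics M

    close′ : ∀ i g → {True (2 ≤? g)} → {True (suc g <? 7)} → CloseHolds (i , g + i)
    close′ i g {2≤g} {g<6} = close i g {2≤g} (ℕ.<-≤-trans (toWitness g<6) 7≤m)

  refuted : ⊥
  refuted with change-or-constant (dominator ∘ u) k | ℕ.m≤n⇒m<n∨m≡n 2≤k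
  -- Position `1 + k * 2` is `m`, hence position 0: the far vertices `u 0` and `u 1` would share a
  -- dominator.
  ... | inj₂ eq | _ = contradiction
    (trans (sym (cong dominator (u-periodic 0)))
           (trans (cong (dominator ∘ u) (trans (ℕ.+-identityʳ m) m≡)) eq))
    dominators-differ
  ... | inj₁ t | inj₁ 3≤k  = copath-case (ℕ.+-monoˡ-≤ 1 (ℕ.*-monoʳ-≤ 2 3≤k)) t
  ... | inj₁ t | inj₂ refl = pentagon-case refl t
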